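{- Let $G$ be a finite, simple, connected graph which is not a tree. Then $G$ contains a cycle which is $W(G)/3$-supported.
   Context: For a vertex $r$ of $G$ (the root) and $x\in V(G)$, let $\ell_r(x)=d_G(r,x)$ (the level of $x$). For an integer $n\ge 0$, let $R_r(n)$ be the set of edges $xy\in E(G)$ with $\max\{\ell_r(x),\ell_r(y)\}>n$, and write $x\simeq_n y$ if $x$ and $y$ lie in the same connected component of the graph $(V(G),R_r(n))$ (in particular $x\simeq_n x$). Define $W(r)=\max_{n\ge 0}\max\{d_G(x,y): \ell_r(x)=\ell_r(y)=n,\ x\simeq_n y\}$ and the cycle width $W(G)=\max_{r\in V(G)}W(r)$. A cycle $C$ in $G$ is called $k$-supported (for a real number $k$) if $C$ can be partitioned into three edge-disjoint paths $I_1,I_2,I_3$, with $I_1\cap I_2$, $I_2\cap I_3$ and $I_3\cap I_1$ each consisting of exactly one vertex, such that for every triple of vertices $(u_1,u_2,u_3)$ with $u_i\in V(I_i)$ we have $\max_{i,j\in\{1,2,3\}} d_G(u_i,u_j)\ge k$. -}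

module Defs where

open import Data.Empty using (⊥-elim)
open import Data.Fin using (Fin; zero; suc; inject₁; fromℕ)
open import Data.Fin.Properties using (any?) renaming (_≟_ to _≟ᶠ_)
open import Data.Integer using (+_)
open import Data.List using (List; []; _∷_; allFin)
open import Data.List.Membership.Propositional using (_∈_)
open import Data.List.Membership.Propositional.Properties using (∈-allFin)
open import Data.List.Relation.Unary.Any using (here; there)
open import Data.Nat using (ℕ; zero; suc; _≤_; _<_; _⊔_; z≤n; s≤s; _≟_; _<?_)
open import Data.Nat.Properties using (≤-trans; m≤m⊔n; m≤n⊔m; n≤0⇒n≡0; ≤∧≢⇒<; ≤-pred)
open import Data.Product using (Σ; ∃; ∃-syntax; ∃!; _×_; _,_; proj₁; proj₂)
open import Data.Rational using (ℚ; _/_) renaming (_≤_ to _≤ℚ_)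
open import Data.Sum using (_⊎_; inj₁; inj₂)
open import Data.Vec.Functional using (foldr)
open import Function using (_∘_)
open import Function.Bundles using (_⇔_)
open import Function.Definitions using (Injective)
open import Level using (0ℓ)
open import Relation.Binary.Construct.Closure.ReflexiveTransitive using (Star; ε; _◅_; _◅◅_)
open import Relation.Binary.Core using (Rel)
import Relation.Binary.Definitions as B
open import Relation.Binary.PropositionalEquality using (_≡_; _≢_; refl; subst)
open import Relation.Nullary using (¬_; yes; no)
open import Relation.Nullary.Decidable using (map′; _×-dec_; _⊎-dec_)
open import Relation.Unary using (Pred; Decidable)

IsMinimum IsMaximum : Pred ℕ 0ℓ → ℕ → Set
IsMinimum P m = P m × (∀ k → P k → m ≤ k)
IsMaximum P m = P m × (∀ k → P k → k ≤ m)

minimum-exists : {P : Pred ℕ 0ℓ} → Decidable P → ∃ P → ∃ (IsMinimum P)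
minimum-exists {P} P? (w , pw) = go P? w pw
  where
  go : {Q : Pred ℕ 0ℓ} → Decidable Q → ∀ k → Q k → ∃ (IsMinimum Q)
  go Q? zero q = 0 , q , λ _ _ → z≤n
  go {Q} Q? (suc k) q with Q? 0
  ... | yes q₀ = 0 , q₀ , λ _ _ → z≤n
  ... | no ¬q₀ with go (Q? ∘ suc) k q
  ...   | m , qm , min = suc m , qm , min′
    where
    min′ : ∀ j → Q j → suc m ≤ j
    min′ zero    q₀ = ⊥-elim (¬q₀ q₀)
    min′ (suc j) qj = s≤s (min j qj)

maximum-exists : {P : Pred ℕ 0ℓ} → Decidable P → ∃ P →
                 ∀ b → (∀ k → P k → k ≤ b) → ∃ (IsMaximum P)
maximum-exists {P} P? (w , pw) zero bd = 0 , subst P (n≤0⇒n≡0 (bd w pw)) pw , bd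
maximum-exists {P} P? wit (suc b) bd with P? (suc b)
... | yes p = suc b , p , bd
... | no ¬p = maximum-exists P? wit b λ k pk →
                ≤-pred (≤∧≢⇒< (bd k pk) λ { refl → ¬p pk })

max : ∀ {n} → (Fin n → ℕ) → ℕ
max = foldr _⊔_ 0

≤max : ∀ {n} (f : Fin n → ℕ) i → f i ≤ max f
≤max f zero    = m≤m⊔n _ _
≤max f (suc i) = ≤-trans (≤max (f ∘ suc) i) (m≤n⊔m (f zero) _)

-- Reachability in a finite decidable graph is decidable (Warshall's algorithm):
-- `Via R vs x y` says that y is reachable from x with interior vertices in vs.
module _ {n : ℕ} (R : Rel (Fin n) 0ℓ) where

  Via : List (Fin n) → Rel (Fin n) 0ℓ
  Via []       x y = x ≡ y ⊎ R x y
  Via (v ∷ vs) x y = Via vs x y ⊎ (Via vs x v × Via vs v y)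

  Via⇒Star : ∀ vs {x y} → Via vs x y → Star R x y
  Via⇒Star []       (inj₁ refl)    = ε
  Via⇒Star []       (inj₂ r)       = r ◅ ε
  Via⇒Star (v ∷ vs) (inj₁ p)       = Via⇒Star vs p
  Via⇒Star (v ∷ vs) (inj₂ (p , q)) = Via⇒Star vs p ◅◅ Via⇒Star vs q

  Via-base : ∀ vs {x y} → x ≡ y ⊎ R x y → Via vs x y
  Via-base []       p = p
  Via-base (v ∷ vs) p = inj₁ (Via-base vs p)

  Via-to : ∀ v vs {x} → Via (v ∷ vs) x v → Via vs x v
  Via-to v vs (inj₁ p)       = p
  Via-to v vs (inj₂ (p , _)) = p

  Via-from : ∀ v vs {y} → Via (v ∷ vs) v y → Via vs v y
  Via-from v vs (inj₁ p)       = p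
  Via-from v vs (inj₂ (_ , p)) = p

  Via-trans : ∀ vs {x v y} → v ∈ vs → Via vs x v → Via vs v y → Via vs x y
  Via-trans (w ∷ vs) (here refl) p q = inj₂ (Via-to w vs p , Via-from w vs q)
  Via-trans (w ∷ vs) (there m) (inj₁ p)       (inj₁ q)       = inj₁ (Via-trans vs m p q)
  Via-trans (w ∷ vs) (there m) (inj₁ p)       (inj₂ (q , s)) = inj₂ (Via-trans vs m p q , s)
  Via-trans (w ∷ vs) (there m) (inj₂ (p , q)) (inj₁ s)       = inj₂ (p , Via-trans vs m q s)
  Via-trans (w ∷ vs) (there m) (inj₂ (p , _)) (inj₂ (_ , s)) = inj₂ (p , s)

  Star⇒Via : ∀ {x y} → Star R x y → Via (allFin n) x y
  Star⇒Via ε        = Via-base (allFin n) (inj₁ refl)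
  Star⇒Via (r ◅ rs) =
    Via-trans (allFin n) (∈-allFin _) (Via-base (allFin n) (inj₂ r)) (Star⇒Via rs)

  module _ (R? : B.Decidable R) where

    via? : ∀ vs → B.Decidable (Via vs)
    via? []       x y = (x ≟ᶠ y) ⊎-dec R? x y
    via? (v ∷ vs) x y = via? vs x y ⊎-dec (via? vs x v ×-dec via? vs v y)

    star? : B.Decidable (Star R)
    star? x y = map′ (Via⇒Star (allFin n)) Star⇒Via (via? (allFin n) x y)

record Graph : Set₁ where
  field
    order  : ℕ
  Vertex : Set
  Vertex = Fin order
  field
    Adj    : Rel Vertex 0ℓ
    adj?   : B.Decidable Adj
    symm   : B.Symmetric Adj
    irrefl : ∀ {x} → ¬ Adj x x

open Graph public using (Vertex)

module _ (G : Graph) where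
  open Graph G hiding (Vertex)

  data Walk : Vertex G → Vertex G → ℕ → Set where
    nil  : ∀ {x} → Walk x x 0
    cons : ∀ {x y z k} → Adj x y → Walk y z k → Walk x z (suc k)

  walk? : ∀ x y → Decidable (Walk x y)
  walk? x y zero    = map′ (λ { refl → nil }) (λ { nil → refl }) (x ≟ᶠ y)
  walk? x y (suc k) = map′ (λ { (_ , a , w) → cons a w }) (λ { (cons a w) → _ , a , w })
                           (any? λ z → adj? x z ×-dec walk? z y k)

  Connected : Set
  Connected = ∀ x y → ∃ (Walk x y)

  record Path : Set where
    field
      len       : ℕ
      vertex    : Fin (suc len) → Vertex G
      injective : Injective _≡_ _≡_ vertex
      adjacent  : ∀ i → Adj (vertex (inject₁ i)) (vertex (suc i))
    first last : Vertex G
    first = vertex zero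
    last  = vertex (fromℕ len)

  -- A cycle is a path on at least three vertices together with the edge
  -- joining its last vertex to its first.
  record Cycle : Set where
    field
      path   : Path
      long   : 2 ≤ Path.len path
      closes : Adj (Path.last path) (Path.first path)

  Acyclic : Set
  Acyclic = ¬ Cycle

  IsTree : Set
  IsTree = Connected × Acyclic

module _ {G : Graph} where

  _∈ᴾ_ : Vertex G → Path G → Set
  x ∈ᴾ P = ∃[ i ] Path.vertex P i ≡ x

  _∈ᶜ_ : Vertex G → Cycle G → Set
  x ∈ᶜ C = x ∈ᴾ Cycle.path C

  -- Equality of the unordered pairs {a , b} and {x , y}.
  SamePair : (a b x y : Vertex G) → Set
  SamePair a b x y = (a ≡ x × b ≡ y) ⊎ (a ≡ y × b ≡ x)

  PathEdge : Path G → Rel (Vertex G) 0ℓ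
  PathEdge P x y = ∃[ i ] SamePair (vertex (inject₁ i)) (vertex (suc i)) x y
    where open Path P

  CycleEdge : Cycle G → Rel (Vertex G) 0ℓ
  CycleEdge C x y = PathEdge path x y ⊎ SamePair (Path.last path) (Path.first path) x y
    where open Cycle C

  record PartitionsInto (C : Cycle G) (I : Fin 3 → Path G) : Set where
    field
      vertices      : ∀ x → x ∈ᶜ C ⇔ (∃[ i ] x ∈ᴾ I i)
      edges         : ∀ x y → CycleEdge C x y ⇔ (∃[ i ] PathEdge (I i) x y)
      edge-disjoint : ∀ {i j} → i ≢ j → ∀ x y → ¬ (PathEdge (I i) x y × PathEdge (I j) x y)
      meet-once     : ∀ {i j} → i ≢ j → ∃! _≡_ (λ x → x ∈ᴾ I i × x ∈ᴾ I j)

module _ {G : Graph} (conn : Connected G) where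
  open Graph G using (Adj; adj?)

  distance : ∀ x y → ∃ (IsMinimum (Walk G x y))
  distance x y = minimum-exists (walk? G x y) (conn x y)

  dist : Vertex G → Vertex G → ℕ
  dist x y = proj₁ (distance x y)

  level : Vertex G → Vertex G → ℕ
  level r x = dist r x

  OuterEdge : Vertex G → ℕ → Rel (Vertex G) 0ℓ
  OuterEdge r n x y = Adj x y × n < level r x ⊔ level r y

  -- OuterEdge is symmetric, so its reflexive-transitive closure relates
  -- exactly the vertices in the same connected component.
  SameComponent : Vertex G → ℕ → Rel (Vertex G) 0ℓ
  SameComponent r n = Star (OuterEdge r n)

  WidthValue : Vertex G → ℕ → Set
  WidthValue r k = ∃[ n ] ∃[ x ] ∃[ y ]
    level r x ≡ n × level r y ≡ n × SameComponent r n x y × dist x y ≡ k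

  private
    widthValue? : ∀ r → Decidable (WidthValue r)
    widthValue? r k = map′
      (λ { (x , y , e , s , d) → _ , x , y , refl , e , s , d })
      (λ { (_ , x , y , refl , e , s , d) → x , y , e , s , d })
      (any? λ x → any? λ y →
        (level r y ≟ level r x) ×-dec
        (star? _ (λ a b → adj? a b ×-dec (level r x <? level r a ⊔ level r b)) x y ×-dec
         (dist x y ≟ k)))

    widthValue-bounded : ∀ r k → WidthValue r k → k ≤ max (λ x → max (dist x))
    widthValue-bounded r _ (_ , x , y , _ , _ , _ , refl) =
      ≤-trans (≤max (dist x) y) (≤max (λ x → max (dist x)) x)

  rootWidth-max : ∀ r → ∃ (IsMaximum (WidthValue r))
  rootWidth-max r = maximum-exists (widthValue? r)
    (_ , _ , r , r , refl , refl , ε , refl) _ (widthValue-bounded r)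

  rootWidth : Vertex G → ℕ
  rootWidth r = proj₁ (rootWidth-max r)

  cycleWidth : ℕ
  cycleWidth = max rootWidth

  IsSupported : Cycle G → ℚ → Set
  IsSupported C k = Σ (Fin 3 → Path G) λ I → PartitionsInto C I ×
    (∀ (u : Fin 3 → Vertex G) → (∀ i → u i ∈ᴾ I i) →
      k ≤ℚ + max (λ i → max (λ j → dist (u i) (u j))) / 1)

{-# OPTIONS --safe #-}

-- If the width is positive, let it be d(x , y) with x and y at level n and joined
-- outside the ball of radius n.  A simple path Q from x to y made of outer edges
-- stays at levels ≥ n, and geodesics from x and y towards the root, followed until
-- they first meet at z, stay at levels < n after their first vertex.  Together they
-- form a cycle with arcs x–z, y–z and Q.  A vertex u on x–z satisfies
-- d(x , u) = n − ℓ(u), which is at most the distance from u to any vertex of Q, and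
-- likewise for y, so d(x , y) ≤ d(x , u₁) + d(u₁ , u₂) + d(u₂ , y) is at most three
-- times the largest distance within a triple.  If the width is 0, any cycle works.
module Submission where

open import Defs
open import Data.Empty using (⊥-elim)
open import Data.Fin using (Fin; zero; suc; inject₁; fromℕ)
open import Data.Fin.Patterns using (0F; 1F; 2F)
open import Data.Fin.Properties using (any?; fromℕ≢inject₁) renaming (_≟_ to _≟ᶠ_)
import Data.Integer as ℤ
open import Data.Integer using (+_; +≤+)
open import Data.Integer.Properties using (pos-*)
open import Data.Nat using (ℕ; zero; suc; _+_; _*_; _≤_; z≤n; s≤s)
open import Data.Nat.Properties
open import Data.Product using (Σ; ∃-syntax; ∃!; _×_; _,_; proj₁; proj₂)
open import Data.Rational using (_/_) renaming (_≤_ to _≤ℚ_)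
open import Data.Rational.Properties using (toℚᵘ-cancel-≤; toℚᵘ-fromℚᵘ)
open import Data.Rational.Unnormalised using (mkℚᵘ; *≤*)
import Data.Rational.Unnormalised.Properties as ℚᵘ
open import Data.Sum using (_⊎_; inj₁; inj₂; [_,_]′; map₂)
open import Data.Unit using (⊤; tt)
open import Function using (_∘_)
open import Function.Bundles using (mk⇔)
open import Function.Definitions using (Injective)
open import Level using (0ℓ)
open import Relation.Binary.Construct.Closure.ReflexiveTransitive using (Star; ε; _◅_)
open import Relation.Binary.Core using (Rel)
open import Relation.Binary.PropositionalEquality using (_≡_; _≢_; refl; sym; trans; cong; subst)
open import Relation.Nullary using (¬_; Dec; yes; no; contradiction)
open import Relation.Nullary.Decidable using (_×-dec_; _⊎-dec_; ¬?)

-- Rational comparison, finite maxima and chains.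

/3≤/1 : ∀ w m → w ≤ m * 3 → + w / 3 ≤ℚ + m / 1
-- Fractions in `ℚ` are reduced by a gcd that does not compute for a variable numerator; among
-- unnormalised rationals the order is cross-multiplication.
/3≤/1 w m w≤3m = toℚᵘ-cancel-≤
  (ℚᵘ.≤-respˡ-≃ (ℚᵘ.≃-sym (toℚᵘ-fromℚᵘ (mkℚᵘ (+ w) 2)))
    (ℚᵘ.≤-respʳ-≃ (ℚᵘ.≃-sym (toℚᵘ-fromℚᵘ (mkℚᵘ (+ m) 0))) (*≤* w*1≤m*3)))
  where
  w*1≤m*3 : + w ℤ.* + 1 ℤ.≤ + m ℤ.* + 3
  w*1≤m*3 rewrite sym (pos-* w 1) | sym (pos-* m 3) | *-identityʳ w = +≤+ w≤3m

-- The empty family has maximum 0 and attains nothing, hence the first alternative.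
max-attained : ∀ {n} (f : Fin n → ℕ) → max f ≡ 0 ⊎ (∃[ i ] f i ≡ max f)
max-attained {zero}  f = inj₁ refl
max-attained {suc n} f with ⊔-sel (f zero) (max (f ∘ suc)) | max-attained (f ∘ suc)
... | inj₁ e | _            = inj₂ (zero , sym e)
... | inj₂ e | inj₁ e₀      = inj₁ (trans e e₀)
... | inj₂ e | inj₂ (i , q) = inj₂ (suc i , trans q (sym e))

sequence⇒Star : {A : Set} {R : Rel A 0ℓ} → ∀ n (f : Fin (suc n) → A) →
                (∀ i → R (f (inject₁ i)) (f (suc i))) → Star R (f zero) (f (fromℕ n))
sequence⇒Star zero    f r = ε
sequence⇒Star (suc n) f r = r zero ◅ sequence⇒Star n (f ∘ suc) (r ∘ suc)

module _ {G : Graph} where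
  open Graph G using (Adj; adj?; symm; irrefl)

  private variable
    x y z v : Vertex G
    k l m   : ℕ

  -- Walks

  infixr 5 _++_
  infix 4 _∈_ _∉_

  _++_ : Walk G x y k → Walk G y z l → Walk G x z (k + l)
  nil      ++ w′ = w′
  cons a w ++ w′ = cons a (w ++ w′)

  snoc : Walk G x y k → Adj y z → Walk G x z (suc k)
  snoc nil        a = cons a nil
  snoc (cons b w) a = cons b (snoc w a)

  reverse : Walk G x y k → Walk G y x k
  reverse nil        = nil
  reverse (cons a w) = snoc (reverse w) (symm a)

  data _∈_ (v : Vertex G) : Walk G x y k → Set where
    here  : {w : Walk G v y k} → v ∈ w
    there : {a : Adj x y} {w : Walk G y z k} → v ∈ w → v ∈ cons a w

  _∉_ : Vertex G → Walk G x y k → Set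
  v ∉ w = ¬ v ∈ w

  _∈?_ : ∀ v (w : Walk G x y k) → Dec (v ∈ w)
  _∈?_ {x = x} v w with v ≟ᶠ x
  _∈?_ v w          | yes refl = yes here
  _∈?_ v nil        | no v≢x   = no λ { here → v≢x refl }
  _∈?_ v (cons a w) | no v≢x with v ∈? w
  ... | yes v∈w = yes (there v∈w)
  ... | no v∉w  = no λ { here → v≢x refl ; (there v∈w) → v∉w v∈w }

  last∈ : (w : Walk G x y k) → y ∈ w
  last∈ nil        = here
  last∈ (cons a w) = there (last∈ w)

  ∈-nil : v ∈ nil {x = x} → v ≡ x
  ∈-nil here = refl

  ∈-++⁺ˡ : {w : Walk G x y k} {w′ : Walk G y z l} → v ∈ w → v ∈ w ++ w′
  ∈-++⁺ˡ here        = here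
  ∈-++⁺ˡ (there v∈w) = there (∈-++⁺ˡ v∈w)

  ∈-++⁺ʳ : (w : Walk G x y k) {w′ : Walk G y z l} → v ∈ w′ → v ∈ w ++ w′
  ∈-++⁺ʳ nil        v∈w′ = v∈w′
  ∈-++⁺ʳ (cons a w) v∈w′ = there (∈-++⁺ʳ w v∈w′)

  ∈-++⁻ : (w : Walk G x y k) {w′ : Walk G y z l} → v ∈ w ++ w′ → v ∈ w ⊎ v ∈ w′
  ∈-++⁻ nil        v∈w′        = inj₂ v∈w′
  ∈-++⁻ (cons a w) here        = inj₁ here
  ∈-++⁻ (cons a w) (there v∈p) with ∈-++⁻ w v∈p
  ... | inj₁ v∈w  = inj₁ (there v∈w)
  ... | inj₂ v∈w′ = inj₂ v∈w′

  ∈-snoc⁻ : (w : Walk G x y k) {a : Adj y z} → v ∈ snoc w a → v ∈ w ⊎ v ≡ z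
  ∈-snoc⁻ nil        here         = inj₁ here
  ∈-snoc⁻ nil        (there v∈)   = inj₂ (∈-nil v∈)
  ∈-snoc⁻ (cons b w) here         = inj₁ here
  ∈-snoc⁻ (cons b w) (there v∈p) with ∈-snoc⁻ w v∈p
  ... | inj₁ v∈w = inj₁ (there v∈w)
  ... | inj₂ v≡z = inj₂ v≡z

  Simple : Walk G x y k → Set
  Simple nil                = ⊤
  Simple (cons {x = x} a w) = x ∉ w × Simple w

  Simple-++ : (w : Walk G x y k) {w′ : Walk G y z l} → Simple w → Simple w′ →
              (∀ {v} → v ∈ w → v ∈ w′ → v ≡ y) → Simple (w ++ w′)
  Simple-++ nil        _            s′ meet = s′
  Simple-++ (cons a w) (x∉w , s) s′ meet =
    -- A recurrence of `x` in `w′` would force `x ≡ y`, yet `y` ends `w`, which avoids `x`.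
    (λ x∈p → [ x∉w , (λ x∈w′ → x∉w (subst (_∈ w) (sym (meet here x∈w′)) (last∈ w))) ]′ (∈-++⁻ w x∈p)) ,
    Simple-++ w s s′ (meet ∘ there)

  Simple-snoc : (w : Walk G x y k) {a : Adj y z} → Simple w → z ∉ w → Simple (snoc w a)
  Simple-snoc nil        _         z∉w = (λ { here → z∉w here }) , tt
  Simple-snoc (cons b w) (x∉w , s) z∉w =
    (λ x∈p → [ x∉w , (λ { refl → z∉w here }) ]′ (∈-snoc⁻ w x∈p)) ,
    Simple-snoc w s (z∉w ∘ there)

  Simple⇒ends-distinct : (w : Walk G x y (suc k)) → Simple w → x ≢ y
  Simple⇒ends-distinct (cons a w) (x∉w , _) refl = x∉w (last∈ w)

  Steps : Rel (Vertex G) 0ℓ → Walk G x y k → Set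
  Steps R nil                    = ⊤
  Steps R (cons {x = x} {y} a w) = R x y × Steps R w

  module _ {R : Rel (Vertex G) 0ℓ} where

    SimpleR : Vertex G → Vertex G → Set
    SimpleR x y = ∃[ k ] Σ (Walk G x y k) λ w → Simple w × Steps R w

    simple-suffix : (w : Walk G x y k) → Simple w → Steps R w → v ∈ w → SimpleR v y
    simple-suffix w          s       r       here        = _ , w , s , r
    simple-suffix (cons a w) (_ , s) (_ , r) (there v∈w) = simple-suffix w s r v∈w

    -- Loop erasure from the front: if the new first vertex already lies on the simple walk built so
    -- far, only the suffix from that occurrence is kept.
    Star⇒simple-walk : (∀ {x y} → R x y → Adj x y) → Star R x y → SimpleR x y
    Star⇒simple-walk         R⇒Adj ε = 0 , nil , tt , tt
    Star⇒simple-walk {x = x} R⇒Adj (r ◅ rs) with Star⇒simple-walk R⇒Adj rs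
    ... | _ , w , s , rw with x ∈? w
    ...   | yes x∈w = simple-suffix w s rw x∈w
    ...   | no x∉w  = _ , cons (R⇒Adj r) w , (x∉w , s) , (r , rw)

  -- Paths from simple walks

  at : Walk G x y k → Fin (suc k) → Vertex G
  at {x = x} _  zero    = x
  at (cons a w) (suc i) = at w i

  at∈ : (w : Walk G x y k) (i : Fin (suc k)) → at w i ∈ w
  at∈ w          zero    = here
  at∈ (cons a w) (suc i) = there (at∈ w i)

  at-last : (w : Walk G x y k) → at w (fromℕ k) ≡ y
  at-last nil        = refl
  at-last (cons a w) = at-last w

  at-injective : (w : Walk G x y k) → Simple w → Injective _≡_ _≡_ (at w)
  at-injective w _ {zero} {zero} _ = refl
  at-injective (cons a w) (x∉w , _) {zero}  {suc j} e = ⊥-elim (x∉w (subst (_∈ w) (sym e) (at∈ w j)))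
  at-injective (cons a w) (x∉w , _) {suc i} {zero}  e = ⊥-elim (x∉w (subst (_∈ w) e (at∈ w i)))
  at-injective (cons a w) (_ , s)   {suc i} {suc j} e = cong suc (at-injective w s e)

  at-adjacent : (w : Walk G x y k) → ∀ i → Adj (at w (inject₁ i)) (at w (suc i))
  at-adjacent (cons a w) zero    = a
  at-adjacent (cons a w) (suc i) = at-adjacent w i

  toPath : (w : Walk G x y k) → Simple w → Path G
  toPath {k = k} w s = record
    { len       = k
    ; vertex    = at w
    ; injective = at-injective w s
    ; adjacent  = at-adjacent w
    }

  ∈⇒at : (w : Walk G x y k) → v ∈ w → ∃[ i ] at w i ≡ v
  ∈⇒at w          here        = zero , refl
  ∈⇒at (cons a w) (there v∈w) = let i , e = ∈⇒at w v∈w in suc i , e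

  at⇒∈ : (w : Walk G x y k) → ∃[ i ] at w i ≡ v → v ∈ w
  at⇒∈ w (i , refl) = at∈ w i

  -- Definitionally `PathEdge` of `toPath w s` for any `s`, so edges of arcs and of the cycle are
  -- exchanged without conversion.
  Edge : Walk G x y k → Rel (Vertex G) 0ℓ
  Edge w u v = ∃[ i ] SamePair {G} (at w (inject₁ i)) (at w (suc i)) u v

  module _ {u v : Vertex G} where

    Edge-cons⁺ : {a : Adj x y} {w : Walk G y z k} → Edge w u v → Edge (cons a w) u v
    Edge-cons⁺ (i , e) = suc i , e

    Edge-++⁺ˡ : (w : Walk G x y k) {w′ : Walk G y z l} → Edge w u v → Edge (w ++ w′) u v
    Edge-++⁺ˡ (cons a w) (zero , e)  = zero , e
    Edge-++⁺ˡ (cons a w) {w′} (suc i , e) = Edge-cons⁺ {a = a} {w = w ++ w′} (Edge-++⁺ˡ w (i , e))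

    Edge-++⁺ʳ : (w : Walk G x y k) {w′ : Walk G y z l} → Edge w′ u v → Edge (w ++ w′) u v
    Edge-++⁺ʳ nil        e = e
    Edge-++⁺ʳ (cons a w) {w′} e = Edge-cons⁺ {a = a} {w = w ++ w′} (Edge-++⁺ʳ w e)

    Edge-++⁻ : (w : Walk G x y k) {w′ : Walk G y z l} → Edge (w ++ w′) u v → Edge w u v ⊎ Edge w′ u v
    Edge-++⁻ nil        e           = inj₂ e
    Edge-++⁻ (cons a w) (zero , e)  = inj₁ (zero , e)
    Edge-++⁻ (cons a w) (suc i , e) with Edge-++⁻ w (i , e)
    ... | inj₁ (j , e′) = inj₁ (suc j , e′)
    ... | inj₂ e′       = inj₂ e′

  PathEdge⇒ends : (P : Path G) → ∀ {x y} → PathEdge P x y → x ∈ᴾ P × y ∈ᴾ P × x ≢ y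
  PathEdge⇒ends P (i , inj₁ (refl , refl)) =
    (_ , refl) , (_ , refl) , λ e → irrefl (subst (Adj _) (sym e) (Path.adjacent P i))
  PathEdge⇒ends P (i , inj₂ (refl , refl)) =
    (_ , refl) , (_ , refl) , λ e → irrefl (subst (Adj _) e (Path.adjacent P i))

  MeetOnce : Rel (Path G) 0ℓ
  MeetOnce P Q = ∃! _≡_ (λ x → x ∈ᴾ P × x ∈ᴾ Q)

  -- The two ends of a common edge would be two distinct common vertices.
  MeetOnce⇒edge-disjoint : ∀ {P Q} → MeetOnce P Q → ∀ x y → ¬ (PathEdge P x y × PathEdge Q x y)
  MeetOnce⇒edge-disjoint {P} {Q} (_ , _ , uniq) x y (p , q)
    with PathEdge⇒ends P p | PathEdge⇒ends Q q
  ... | x∈P , y∈P , x≢y | x∈Q , y∈Q , _ = x≢y (trans (sym (uniq (x∈P , x∈Q))) (uniq (y∈P , y∈Q)))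

  MeetOnce-sym : ∀ P Q → MeetOnce P Q → MeetOnce Q P
  MeetOnce-sym _ _ (x , (p , q) , uniq) = x , (q , p) , λ (q , p) → uniq (p , q)

  -- Cycles from three arcs

  -- Successor lengths give every arc an edge, so the corners are distinct and the closed walk has
  -- at least three edges.
  record Triangle : Set where
    field
      {a b c}  : Vertex G
      {∣ab∣ ∣bc∣ ∣ca∣} : ℕ
      ab       : Walk G a b (suc ∣ab∣)
      bc       : Walk G b c (suc ∣bc∣)
      ca       : Walk G c a (suc ∣ca∣)
      s-ab     : Simple ab
      s-bc     : Simple bc
      s-ca     : Simple ca
      ab∩bc    : ∀ {v} → v ∈ ab → v ∈ bc → v ≡ b
      bc∩ca    : ∀ {v} → v ∈ bc → v ∈ ca → v ≡ c
      ca∩ab    : ∀ {v} → v ∈ ca → v ∈ ab → v ≡ a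

  module _ (T : Triangle) where
    open Triangle T

    arc : Fin 3 → Path G
    arc 0F = toPath ab s-ab
    arc 1F = toPath bc s-bc
    arc 2F = toPath ca s-ca

    arc-meet-once : ∀ {i j} → i ≢ j → MeetOnce (arc i) (arc j)
    arc-meet-once {0F} {0F} i≢j = contradiction refl i≢j
    arc-meet-once {1F} {1F} i≢j = contradiction refl i≢j
    arc-meet-once {2F} {2F} i≢j = contradiction refl i≢j
    arc-meet-once {0F} {1F} _ = b , (∈⇒at ab (last∈ ab) , ∈⇒at bc here) ,
      λ (p , q) → sym (ab∩bc (at⇒∈ ab p) (at⇒∈ bc q))
    arc-meet-once {1F} {2F} _ = c , (∈⇒at bc (last∈ bc) , ∈⇒at ca here) ,
      λ (p , q) → sym (bc∩ca (at⇒∈ bc p) (at⇒∈ ca q))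
    arc-meet-once {2F} {0F} _ = a , (∈⇒at ca (last∈ ca) , ∈⇒at ab here) ,
      λ (p , q) → sym (ca∩ab (at⇒∈ ca p) (at⇒∈ ab q))
    arc-meet-once {1F} {0F} _ = MeetOnce-sym (arc 0F) (arc 1F) (arc-meet-once {0F} {1F} λ ())
    arc-meet-once {2F} {1F} _ = MeetOnce-sym (arc 1F) (arc 2F) (arc-meet-once {1F} {2F} λ ())
    arc-meet-once {0F} {2F} _ = MeetOnce-sym (arc 2F) (arc 0F) (arc-meet-once {2F} {0F} λ ())

  -- The closing edge of the cycle is the first edge of the arc ab.
  triangle-cycle : (T : Triangle) → Σ (Cycle G) λ C → PartitionsInto C (arc T)
  triangle-cycle T@record
    { ∣ab∣  = k
    ; ∣bc∣  = l
    ; ∣ca∣  = m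
    ; ab    = cons e w
    ; bc    = bc
    ; ca    = ca
    ; s-ab  = a∉w , s-w
    ; s-bc  = s-bc
    ; s-ca  = s-ca
    ; ab∩bc = ab∩bc
    ; bc∩ca = bc∩ca
    ; ca∩ab = ca∩ab
    } = C , record
    { vertices      = λ v → mk⇔ (vertices⁺ ∘ at⇒∈ p) (∈⇒at p ∘ vertices⁻)
    ; edges         = λ u v → mk⇔ edges⁺ edges⁻
    ; edge-disjoint = λ {i} {j} i≢j → MeetOnce⇒edge-disjoint {arc T i} {arc T j} (arc-meet-once T i≢j)
    ; meet-once     = arc-meet-once T
    }
    where
    p = w ++ bc ++ ca

    s-p : Simple p
    s-p = Simple-++ w s-w (Simple-++ bc s-bc s-ca bc∩ca) λ v∈w v∈q →
      [ ab∩bc (there v∈w)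
      -- The arcs `ca` and `ab` share only `a`, which has been cut off from `w`.
      , (λ v∈ca → ⊥-elim (a∉w (subst (_∈ w) (ca∩ab v∈ca (there v∈w)) v∈w)))
      ]′ (∈-++⁻ bc v∈q)

    C : Cycle G
    C = record
      { path   = toPath p s-p
      -- Without the first edge of `ab` the length is `k + (suc l + suc m)`, so `bc` and `ca`
      -- already supply two edges.
      ; long   = ≤-trans (s≤s (≤-trans (s≤s z≤n) (m≤n+m (suc m) l))) (m≤n+m (suc l + suc m) k)
      ; closes = subst (λ v → Adj v _) (sym (at-last p)) e
      }

    vertices⁺ : v ∈ p → ∃[ i ] v ∈ᴾ arc T i
    vertices⁺ v∈p with ∈-++⁻ w v∈p
    ... | inj₁ v∈w = 0F , ∈⇒at (cons e w) (there v∈w)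
    ... | inj₂ v∈q with ∈-++⁻ bc v∈q
    ...   | inj₁ v∈bc = 1F , ∈⇒at bc v∈bc
    ...   | inj₂ v∈ca = 2F , ∈⇒at ca v∈ca

    vertices⁻ : ∃[ i ] v ∈ᴾ arc T i → v ∈ p
    vertices⁻ (0F , v∈) with at⇒∈ (cons e w) v∈
    -- The corner `a` is not on `w`; it occurs in `p` as the last vertex of `ca`.
    ... | here      = ∈-++⁺ʳ w (∈-++⁺ʳ bc (last∈ ca))
    ... | there v∈w = ∈-++⁺ˡ v∈w
    vertices⁻ (1F , v∈) = ∈-++⁺ʳ w (∈-++⁺ˡ (at⇒∈ bc v∈))
    vertices⁻ (2F , v∈) = ∈-++⁺ʳ w (∈-++⁺ʳ bc (at⇒∈ ca v∈))

    edges⁺ : ∀ {u v} → CycleEdge C u v → ∃[ i ] PathEdge (arc T i) u v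
    edges⁺ (inj₂ e) = 0F , zero , subst (λ z → SamePair {G} z _ _ _) (at-last p) e
    edges⁺ (inj₁ e) with Edge-++⁻ w e
    ... | inj₁ (i , e′) = 0F , suc i , e′
    ... | inj₂ e′ with Edge-++⁻ bc e′
    ...   | inj₁ e″ = 1F , e″
    ...   | inj₂ e″ = 2F , e″

    edges⁻ : ∀ {u v} → ∃[ i ] PathEdge (arc T i) u v → CycleEdge C u v
    edges⁻ (0F , zero , e)  = inj₂ (subst (λ z → SamePair {G} z _ _ _) (sym (at-last p)) e)
    edges⁻ (0F , suc i , e) = inj₁ (Edge-++⁺ˡ w (i , e))
    edges⁻ (1F , e)         = inj₁ (Edge-++⁺ʳ w (Edge-++⁺ˡ bc e))
    edges⁻ (2F , e)         = inj₁ (Edge-++⁺ʳ w (Edge-++⁺ʳ bc e))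

  -- Finding a cycle in a graph that is not acyclic

  EdgeOtherThan : Vertex G → Vertex G → Rel (Vertex G) 0ℓ
  EdgeOtherThan x y u v = Adj u v × ¬ SamePair {G} u v x y

  -- Some edge is not a bridge. This form of "some cycle exists" is decidable through `star?`, which
  -- lets an actual cycle be extracted from `¬ Acyclic`.
  HasCycleEdge : Set
  HasCycleEdge = ∃[ x ] ∃[ y ] Adj x y × Star (EdgeOtherThan x y) x y

  hasCycleEdge? : Dec HasCycleEdge
  hasCycleEdge? = any? λ x → any? λ y → adj? x y ×-dec
    star? _ (λ u v → adj? u v ×-dec
      ¬? (((u ≟ᶠ x) ×-dec (v ≟ᶠ y)) ⊎-dec ((u ≟ᶠ y) ×-dec (v ≟ᶠ x)))) x y

  -- The closing edge is not a bridge, since the path of the cycle joins its ends. By injectivity a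
  -- path edge with the same ends would run from the first vertex straight to the last, impossible
  -- for length at least two.
  cycle⇒hasCycleEdge : Cycle G → HasCycleEdge
  cycle⇒hasCycleEdge record
    { path   = record { len = suc (suc n) ; vertex = f ; injective = inj ; adjacent = adj }
    ; closes = closes
    } =
    _ , _ , symm closes , sequence⇒Star _ f λ i → adj i , other i
    where
    other : ∀ i → ¬ SamePair {G} (f (inject₁ i)) (f (suc i)) (f zero) (f (fromℕ (suc (suc n))))
    other zero    (inj₁ (_ , e)) = contradiction (inj e) λ ()
    other (suc i) (inj₁ (e , _)) = contradiction (inj e) λ ()
    other i       (inj₂ (e , _)) = fromℕ≢inject₁ (sym (inj e))
  cycle⇒hasCycleEdge record { path = record { len = suc zero } ; long = s≤s () }

  -- A simple detour from `x` to `y` avoiding the edge `xy` has at least two edges. The arcs are the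
  -- edge `yx`, the first edge of the detour, and the rest of it.
  hasCycleEdge⇒triangle : HasCycleEdge → Triangle
  hasCycleEdge⇒triangle (x , y , xy , xs) with Star⇒simple-walk proj₁ xs
  ... | _ , nil , _ = contradiction xy irrefl
  ... | _ , cons _ nil , _ , (_ , ¬xy) , _ = contradiction (inj₁ (refl , refl)) ¬xy
  ... | _ , cons {y = v} xv w@(cons _ _) , (x∉w , s) , _ = record
    { ab    = cons (symm xy) nil
    ; bc    = cons xv nil
    ; ca    = w
    ; s-ab  = (λ { here → irrefl xy }) , tt
    ; s-bc  = (λ { here → irrefl xv }) , tt
    ; s-ca  = s
    ; ab∩bc = λ { here here → refl
                ; here (there y∈) → contradiction (sym (∈-nil y∈)) (Simple⇒ends-distinct w s)
                ; (there v∈) _ → ∈-nil v∈ }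
    ; bc∩ca = λ { here x∈w → contradiction x∈w x∉w ; (there v∈) _ → ∈-nil v∈ }
    ; ca∩ab = λ { _ here → refl ; v∈w (there v∈) → contradiction (subst (_∈ w) (∈-nil v∈) v∈w) x∉w }
    }

  -- Distances

  module _ (conn : Connected G) where

    private
      d : Vertex G → Vertex G → ℕ
      d = dist conn

    geodesic : ∀ x y → Walk G x y (d x y)
    geodesic x y = proj₁ (proj₂ (distance conn x y))

    d≤length : Walk G x y k → d x y ≤ k
    d≤length {x = x} {y} w = proj₂ (proj₂ (distance conn x y)) _ w

    d-refl : ∀ x → d x x ≡ 0
    d-refl x = n≤0⇒n≡0 (d≤length nil)

    d-triangle : ∀ x y z → d x z ≤ d x y + d y z
    d-triangle x y z = d≤length (geodesic x y ++ geodesic y z)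

    d-sym-≤ : ∀ x y → d x y ≤ d y x
    d-sym-≤ x y = d≤length (reverse (geodesic y x))

    d≤0⇒≡ : d x y ≤ 0 → x ≡ y
    d≤0⇒≡ {x} {y} d≤0 with d x y | geodesic x y
    d≤0⇒≡ z≤n | .0 | nil = refl

    -- Levels and descents towards the root.

    module _ (r : Vertex G) where

      private
        ℓ : Vertex G → ℕ
        ℓ = level conn r

      ℓ-adj : Adj x y → ℓ y ≤ suc (ℓ x)
      ℓ-adj {x} a = d≤length (snoc (geodesic r x) a)

      -- The next vertex on a geodesic from `x` to `r` has level at most `k` by the remaining walk,
      -- and at least `k` because an edge changes the level by at most one.
      parent : ∀ x → ℓ x ≡ suc k → ∃[ y ] Adj x y × ℓ y ≡ k
      parent {k} x ℓx = step (subst (Walk G x r) ℓx (reverse (geodesic r x)))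
        where
        step : Walk G x r (suc k) → ∃[ y ] Adj x y × ℓ y ≡ k
        step (cons a w) = _ , a ,
          ≤-antisym (d≤length (reverse w)) (≤-pred (subst (_≤ _) ℓx (ℓ-adj (symm a))))

      -- When `n` is the level of `x`, the triangle inequality gives the reverse bound, so this
      -- places each vertex of `w` on a geodesic from `x` to `r`.
      DescendsFrom : Vertex G → ℕ → Walk G y z k → Set
      DescendsFrom x n w = ∀ {v} → v ∈ w → d x v + ℓ v ≤ n

      -- Two descents cut at their first meeting, oriented from `y` through `apex` to `x` so that a
      -- walk from `x` to `y` closes them into a `Triangle`.
      record MergingDescents (n : ℕ) (x y : Vertex G) : Set where
        field
          {apex}      : Vertex G
          {∣down∣ ∣up∣} : ℕ
          down        : Walk G y apex (suc ∣down∣)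
          up          : Walk G apex x (suc ∣up∣)
          simple-down : Simple down
          simple-up   : Simple up
          meet        : ∀ {v} → v ∈ down → v ∈ up → v ≡ apex
          desc-down   : DescendsFrom y n down
          desc-up     : DescendsFrom x n up

      -- Induction on the level: both vertices move to their parents, which either coincide and
      -- serve as `apex`, or are distinct at the level below. At level 0 both vertices are the root,
      -- so they cannot differ.
      merging-descents : ∀ n {x y} → ℓ x ≡ n → ℓ y ≡ n → x ≢ y → MergingDescents n x y
      merging-descents zero ℓx ℓy x≢y =
        contradiction (trans (sym (d≤0⇒≡ (≤-reflexive ℓx))) (d≤0⇒≡ (≤-reflexive ℓy))) x≢y
      merging-descents (suc n) {x} {y} ℓx ℓy x≢y with parent x ℓx | parent y ℓy
      ... | x′ , xx′ , ℓx′ | y′ , yy′ , ℓy′ = extend (x′ ≟ᶠ y′)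
        where
        start : ∀ {u} → ℓ u ≡ suc n → d u u + ℓ u ≤ suc n
        start {u} ℓu = ≤-reflexive (trans (cong (_+ ℓ u) (d-refl u)) ℓu)

        step : ∀ {u u′ v} → Adj u u′ → d u′ v + ℓ v ≤ n → d u v + ℓ v ≤ suc n
        step {u′ = u′} {v} a h = ≤-trans (+-monoˡ-≤ (ℓ v) (d≤length (cons a (geodesic u′ v)))) (s≤s h)

        -- Descents from level `n` stay at levels at most `n`, so they miss a vertex at level
        -- `suc n`.
        outside : ∀ {u v′ p q k} {w : Walk G p q k} → ℓ u ≡ suc n → DescendsFrom v′ n w → u ∉ w
        outside {u} {v′} ℓu desc u∈w =
          1+n≰n (subst (_≤ n) ℓu (≤-trans (m≤n+m (ℓ u) (d v′ u)) (desc u∈w)))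

        extend : Dec (x′ ≡ y′) → MergingDescents (suc n) x y
        extend (yes refl) = record
          { down        = cons yy′ nil
          ; up          = cons (symm xx′) nil
          ; simple-down = (λ y∈ → irrefl (subst (Adj y) (sym (∈-nil y∈)) yy′)) , tt
          ; simple-up   = (λ x′∈ → irrefl (subst (Adj x) (∈-nil x′∈) xx′)) , tt
          ; meet        = λ { (there v∈) _ → ∈-nil v∈
                            ; here here → refl
                            ; here (there y∈) → contradiction (sym (∈-nil y∈)) x≢y }
          ; desc-down   = λ { here → start ℓy ; (there v∈) → step yy′ (trivial ℓy′ v∈) }
          ; desc-up     = λ { here → step xx′ (trivial ℓy′ here)
                            ; (there v∈) → subst (λ v → d x v + ℓ v ≤ suc n) (sym (∈-nil v∈)) (start ℓx) }
          }
          where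
          trivial : ∀ {u} → ℓ u ≡ n → DescendsFrom u n (nil {x = u})
          trivial {u} ℓu v∈ rewrite ∈-nil v∈ | d-refl u = ≤-reflexive ℓu
        extend (no x′≢y′) = record
          { down        = cons yy′ down
          ; up          = snoc up (symm xx′)
          ; simple-down = outside ℓy desc-down , simple-down
          ; simple-up   = Simple-snoc up simple-up (outside ℓx desc-up)
          ; meet        = λ v∈down v∈up → meet′ v∈down (∈-snoc⁻ up v∈up)
          ; desc-down   = λ { here → start ℓy ; (there v∈) → step yy′ (desc-down v∈) }
          ; desc-up     = λ v∈ → [ step xx′ ∘ desc-up , (λ { refl → start ℓx }) ]′ (∈-snoc⁻ up v∈)
          }
          where
          open MergingDescents (merging-descents n ℓx′ ℓy′ x′≢y′)

          meet′ : v ∈ cons yy′ down → v ∈ up ⊎ v ≡ x → v ≡ apex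
          meet′ here       (inj₁ y∈up) = contradiction y∈up (outside ℓy desc-up)
          meet′ here       (inj₂ refl) = contradiction refl x≢y
          meet′ (there v∈) (inj₁ v∈up) = meet v∈ v∈up
          meet′ (there v∈) (inj₂ refl) = contradiction v∈ (outside ℓx desc-down)

      -- Outer walks and the supported cycle.

      -- The higher end of the edge has level above `n`, and the levels of its ends differ by at
      -- most one.
      outer-edge-level : ∀ {n} → OuterEdge conn r n x y → n ≤ ℓ x
      outer-edge-level {x} {y} (a , n<) =
        ≤-pred (≤-trans n< (⊔-lub (n≤1+n (ℓ x)) (ℓ-adj a)))

      outer-walk-level : ∀ {n} (w : Walk G x y k) → Steps (OuterEdge conn r n) w →
                         n ≤ ℓ y → v ∈ w → n ≤ ℓ v
      outer-walk-level nil        _        n≤ℓy here       = n≤ℓy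
      outer-walk-level (cons a w) (o , _)  n≤ℓy here       = outer-edge-level o
      outer-walk-level (cons a w) (_ , os) n≤ℓy (there v∈) = outer-walk-level w os n≤ℓy v∈

      -- Reaching level `n` or more from `u` takes at least `n - ℓ u` steps, and the descent from
      -- `x` to `u` takes no more than that.
      descent-distance : ∀ {n x u v} → d x u + ℓ u ≤ n → n ≤ ℓ v → d x u ≤ d u v
      descent-distance {n} {x} {u} {v} h n≤ℓv = +-cancelʳ-≤ (ℓ u) _ _ (begin
        d x u + ℓ u ≤⟨ h ⟩
        n           ≤⟨ n≤ℓv ⟩
        ℓ v         ≤⟨ d-triangle r u v ⟩
        ℓ u + d u v ≡⟨ +-comm (ℓ u) (d u v) ⟩
        d u v + ℓ u ∎)
        where open ≤-Reasoning

      -- Taking both vertices of `descent-distance` to be `v` bounds `d x v` by `d v v`, which is 0.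
      -- Hence a descent meets an outer walk only at its top.
      descent-top : ∀ {n x v} → d x v + ℓ v ≤ n → n ≤ ℓ v → v ≡ x
      descent-top {x = x} {v} h n≤ℓv =
        sym (d≤0⇒≡ (subst (d x v ≤_) (d-refl v) (descent-distance h n≤ℓv)))

      assemble-cycle : ∀ {n x y k} → MergingDescents n x y → ℓ y ≡ n →
                       (Q : Walk G x y (suc k)) → Simple Q → Steps (OuterEdge conn r n) Q →
                       ∃[ C ] IsSupported conn C (+ d x y / 3)
      assemble-cycle {n} {x} {y} D ℓy Q s-Q outer =
        proj₁ cycle , arc T , proj₂ cycle , λ u u∈ →
          /3≤/1 (d x y) (max λ i → max λ j → d (u i) (u j))
            (bound u (at⇒∈ down (u∈ 0F)) (at⇒∈ up (u∈ 1F)) (at⇒∈ Q (u∈ 2F)))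
        where
        open MergingDescents D

        high : v ∈ Q → n ≤ ℓ v
        high = outer-walk-level Q outer (≤-reflexive (sym ℓy))

        T : Triangle
        T = record
          { ab    = down
          ; bc    = up
          ; ca    = Q
          ; s-ab  = simple-down
          ; s-bc  = simple-up
          ; s-ca  = s-Q
          ; ab∩bc = meet
          ; bc∩ca = λ v∈up v∈Q → descent-top (desc-up v∈up) (high v∈Q)
          ; ca∩ab = λ v∈Q v∈down → descent-top (desc-down v∈down) (high v∈Q)
          }

        cycle = triangle-cycle T

        bound : (u : Fin 3 → Vertex G) → u 0F ∈ down → u 1F ∈ up → u 2F ∈ Q →
                d x y ≤ max (λ i → max (λ j → d (u i) (u j))) * 3
        bound u u₀∈ u₁∈ u₂∈ = begin
          -- The route goes from `x` along `up` to `u 1F`, across to `u 0F` and along `down` to `y`.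
          -- The outer legs are no longer than the distances to `u 2F`; the middle leg is itself a
          -- distance within the triple.
          d x y                                     ≤⟨ d-triangle x (u 1F) y ⟩
          d x (u 1F) + d (u 1F) y                   ≤⟨ +-monoʳ-≤ _ (d-triangle (u 1F) (u 0F) y) ⟩
          d x (u 1F) + (d (u 1F) (u 0F) + d (u 0F) y)
            ≤⟨ +-mono-≤ (≤-trans (descent-distance (desc-up u₁∈) (high u₂∈)) (d≤M 1F 2F))
                 (+-mono-≤ (d≤M 1F 0F)
                   (≤-trans (d-sym-≤ (u 0F) y)
                     (≤-trans (descent-distance (desc-down u₀∈) (high u₂∈)) (d≤M 0F 2F)))) ⟩
          M + (M + M)                               ≡⟨ cong (λ t → M + (M + t)) (+-identityʳ M) ⟨
          3 * M                                     ≡⟨ *-comm 3 M ⟩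
          M * 3                                     ∎
          where
          open ≤-Reasoning
          M = max (λ i → max (λ j → d (u i) (u j)))

          d≤M : ∀ i j → d (u i) (u j) ≤ M
          d≤M i j = ≤-trans (≤max (λ j → d (u i) (u j)) j) (≤max (λ i → max (λ j → d (u i) (u j))) i)

      supported-cycle : ∀ {n x y} → ℓ x ≡ n → ℓ y ≡ n → SameComponent conn r n x y → x ≢ y →
                        ∃[ C ] IsSupported conn C (+ d x y / 3)
      supported-cycle {n} {x} {y} ℓx ℓy xy x≢y = close (Star⇒simple-walk proj₁ xy)
        where
        close : SimpleR {R = OuterEdge conn r n} x y → ∃[ C ] IsSupported conn C (+ d x y / 3)
        close (_ , nil , _) = contradiction refl x≢y
        close (_ , Q@(cons _ _) , s-Q , outer) =
          assemble-cycle (merging-descents n ℓx ℓy x≢y) ℓy Q s-Q outer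

    -- Width zero, and attainment of the width.

    some-0-supported-cycle : ¬ Acyclic G → ∃[ C ] IsSupported conn C (+ 0 / 3)
    some-0-supported-cycle cyclic = by-cases hasCycleEdge?
      where
      by-cases : Dec HasCycleEdge → ∃[ C ] IsSupported conn C (+ 0 / 3)
      by-cases (no ¬h) = contradiction (¬h ∘ cycle⇒hasCycleEdge) cyclic
      by-cases (yes h) = let T = hasCycleEdge⇒triangle h ; C , part = triangle-cycle T in
        C , arc T , part , λ u _ → /3≤/1 0 (max λ i → max λ j → d (u i) (u j)) z≤n

    cycleWidth-attained : cycleWidth conn ≡ 0 ⊎ (∃[ r ] WidthValue conn r (cycleWidth conn))
    cycleWidth-attained = map₂ (λ (r , e) → r ,
      subst (WidthValue conn r) e (proj₁ (proj₂ (rootWidth-max conn r)))) (max-attained (rootWidth conn))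

mainTheorem3 : (G : Graph) (conn : Connected G) → ¬ IsTree G →
    ∃[ C ] IsSupported conn C (+ cycleWidth conn / 3)
mainTheorem3 G conn ¬tree =
  [ zero-width (cycleWidth conn) , positive-width (cycleWidth conn) ]′ (cycleWidth-attained conn)
  where
  Claim : ℕ → Set
  Claim w = ∃[ C ] IsSupported conn C (+ w / 3)

  zero-width : ∀ w → w ≡ 0 → Claim w
  zero-width _ w≡0 = subst Claim (sym w≡0) (some-0-supported-cycle conn (¬tree ∘ (conn ,_)))

  positive-width : ∀ w → (∃[ r ] WidthValue conn r w) → Claim w
  positive-width _ (r , _ , x , y , ℓx , ℓy , xy , d≡w) = subst Claim d≡w (by-cases (x ≟ᶠ y))
    where
    by-cases : Dec (x ≡ y) → Claim (dist conn x y)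
    by-cases (no x≢y)  = supported-cycle conn r ℓx ℓy xy x≢y
    -- An attained width may still be 0, namely when the two vertices coincide.
    by-cases (yes x≡y) = zero-width _ (trans (cong (dist conn x) (sym x≡y)) (d-refl conn x))
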